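{- Let $L$ be either of the sequent calculi $\mathrm{sMC}^*$, $\mathrm{sCN}^*$. The weakening rule (we), "from $\Gamma\Rightarrow\gamma$ infer $\alpha,\Gamma\Rightarrow\gamma$", is admissible in cut-free $L$; that is, for every finite set $\Gamma$ of formulas and all formulas $\alpha,\gamma$, if $\Gamma\Rightarrow\gamma$ is provable in $L-(\mathrm{cut})$, then $\alpha,\Gamma\Rightarrow\gamma$ is provable in $L-(\mathrm{cut})$.
   Context: Formulas are built from countably many propositional variables $p,q,\dots$ using the binary connectives $\land,\lor,\to$ and the unary connective $\sim$. A sequent is an expression $\Gamma\Rightarrow\gamma$ with $\Gamma$ a finite (possibly empty) set of formulas and $\gamma$ a single formula; $\alpha,\Gamma$ means $\{\alpha\}\cup\Gamma$ and $\Gamma,\Delta$ means $\Gamma\cup\Delta$. $L-(\mathrm{cut})$ ("cut-free $L$") is $L$ without the rule (cut). The calculus $\mathrm{sC}$ has the following initial sequents and rules ($p$ any propositional variable; $\alpha,\beta,\gamma$ any formulas; $\Gamma,\Delta,\Sigma$ any finite sets of formulas). Initial sequents: (init1) $p,\Gamma\Rightarrow p$; (init2) $\sim p,\Gamma\Rightarrow\sim p$. (cut): from $\Gamma\Rightarrow\alpha$ and $\alpha,\Sigma\Rightarrow\gamma$ infer $\Gamma,\Sigma\Rightarrow\gamma$. ($\to$left): from $\Gamma\Rightarrow\alpha$ and $\beta,\Delta\Rightarrow\gamma$ infer $\alpha\to\beta,\Gamma,\Delta\Rightarrow\gamma$. ($\to$right): from $\alpha,\Gamma\Rightarrow\beta$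 infer $\Gamma\Rightarrow\alpha\to\beta$. ($\land$left): from $\alpha,\beta,\Gamma\Rightarrow\gamma$ infer $\alpha\land\beta,\Gamma\Rightarrow\gamma$. ($\land$right): from $\Gamma\Rightarrow\alpha$ and $\Gamma\Rightarrow\beta$ infer $\Gamma\Rightarrow\alpha\land\beta$. ($\lor$left): from $\alpha,\Gamma\Rightarrow\gamma$ and $\beta,\Gamma\Rightarrow\gamma$ infer $\alpha\lor\beta,\Gamma\Rightarrow\gamma$. ($\lor$right1), ($\lor$right2): from $\Gamma\Rightarrow\alpha$ (respectively $\Gamma\Rightarrow\beta$) infer $\Gamma\Rightarrow\alpha\lor\beta$. ($\sim$left): from $\alpha,\Gamma\Rightarrow\gamma$ infer $\sim\sim\alpha,\Gamma\Rightarrow\gamma$. ($\sim$right): from $\Gamma\Rightarrow\alpha$ infer $\Gamma\Rightarrow\sim\sim\alpha$. ($\sim\to$left): from $\Gamma\Rightarrow\alpha$ and $\sim\beta,\Delta\Rightarrow\gamma$ infer $\sim(\alpha\to\beta),\Gamma,\Delta\Rightarrow\gamma$. ($\sim\to$right): from $\alpha,\Gamma\Rightarrow\sim\beta$ infer $\Gamma\Rightarrow\sim(\alpha\to\beta)$. ($\sim\land$left): from $\sim\alpha,\Gamma\Rightarrow\gamma$ and $\sim\beta,\Gamma\Rightarrow\gamma$ infer $\sim(\alpha\land\beta),\Gamma\Rightarrow\gamma$. ($\sim\land$right1), ($\sim\land$right2): from $\Gamma\Rightarrow\sim\alpha$ (respectively $\Gamma\Rightarrow\sim\beta$) infer $\Gamma\Rightarrow\sim(\alpha\land\beta)$.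 ($\sim\lor$left): from $\sim\alpha,\sim\beta,\Gamma\Rightarrow\gamma$ infer $\sim(\alpha\lor\beta),\Gamma\Rightarrow\gamma$. ($\sim\lor$right): from $\Gamma\Rightarrow\sim\alpha$ and $\Gamma\Rightarrow\sim\beta$ infer $\Gamma\Rightarrow\sim(\alpha\lor\beta)$. Additional rules: (ex-middle): from $\sim\alpha,\Gamma\Rightarrow\gamma$ and $\alpha,\Gamma\Rightarrow\gamma$ infer $\Gamma\Rightarrow\gamma$. (g-ex-middle): from $\alpha\to\beta,\Gamma\Rightarrow\gamma$ and $\alpha,\Gamma\Rightarrow\gamma$ infer $\Gamma\Rightarrow\gamma$. $\mathrm{sMC}^*=\mathrm{sC}+$(g-ex-middle); $\mathrm{sCN}^*=\mathrm{sC}+$(ex-middle)$+$(g-ex-middle). -}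

module Defs where

open import Data.List using (List; _∷_; _++_)
open import Data.List.Relation.Binary.BagAndSetEquality using (_∼[_]_; set)
open import Data.Nat using (ℕ)
open import Level using (0ℓ)
open import Relation.Unary using (Pred; _∈_; _∩_; _∪_; ∁; ｛_｝)

infix  10 ∼_
infixr 9 _∧_
infixr 8 _∨_
infixr 7 _⊃_
infix  4 _≋_
infix  3 _⊢_⇒_

data Formula : Set where
  var         : ℕ → Formula
  _∧_ _∨_ _⊃_ : Formula → Formula → Formula
  ∼_          : Formula → Formula

-- A finite set of formulas is a list taken up to having the same members:
-- α ∷ Γ stands for {α} ∪ Γ and Γ ++ Δ for Γ ∪ Δ, and the sets denoted by Γ and Δ
-- are equal when Γ ≋ Δ. In particular α may already be a member of Γ in α ∷ Γ.
FiniteSet : Set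
FiniteSet = List Formula

_≋_ : FiniteSet → FiniteSet → Set
Γ ≋ Δ = Γ ∼[ set ] Δ

-- The calculi considered share the initial sequents and logical rules below and
-- differ only in which of these further rules they contain, so a calculus is
-- identified with its set of such rules.
data Rule : Set where
  cut ex-middle g-ex-middle : Rule

Calculus : Set₁
Calculus = Pred Rule 0ℓ

sC sMC* sCN* : Calculus
sC   = ｛ cut ｝
sMC* = sC ∪ ｛ g-ex-middle ｝
sCN* = sC ∪ ｛ ex-middle ｝ ∪ ｛ g-ex-middle ｝

_-cut : Calculus → Calculus
L -cut = L ∩ ∁ ｛ cut ｝

-- L ⊢ Γ ⇒ γ : the sequent Γ ⇒ γ is provable in L. The antecedent Θ of each
-- conclusion is an arbitrary list denoting the set written in the rule, so that
-- provability respects ≋ without any structural rule being added.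
data _⊢_⇒_ (L : Calculus) : FiniteSet → Formula → Set where

  init1 : ∀ {Θ} p Γ → Θ ≋ var p ∷ Γ →
          L ⊢ Θ ⇒ var p

  init2 : ∀ {Θ} p Γ → Θ ≋ ∼ var p ∷ Γ →
          L ⊢ Θ ⇒ ∼ var p

  cut : ∀ {Θ} α γ Γ Σ → cut ∈ L → Θ ≋ Γ ++ Σ →
        L ⊢ Γ ⇒ α →
        L ⊢ α ∷ Σ ⇒ γ →
        L ⊢ Θ ⇒ γ

  ⊃left : ∀ {Θ} α β γ Γ Δ → Θ ≋ (α ⊃ β) ∷ Γ ++ Δ →
          L ⊢ Γ ⇒ α →
          L ⊢ β ∷ Δ ⇒ γ →
          L ⊢ Θ ⇒ γ

  ⊃right : ∀ {Θ} α β Γ → Θ ≋ Γ →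
           L ⊢ α ∷ Γ ⇒ β →
           L ⊢ Θ ⇒ α ⊃ β

  ∧left : ∀ {Θ} α β γ Γ → Θ ≋ (α ∧ β) ∷ Γ →
          L ⊢ α ∷ β ∷ Γ ⇒ γ →
          L ⊢ Θ ⇒ γ

  ∧right : ∀ {Θ} α β Γ → Θ ≋ Γ →
           L ⊢ Γ ⇒ α →
           L ⊢ Γ ⇒ β →
           L ⊢ Θ ⇒ α ∧ β

  ∨left : ∀ {Θ} α β γ Γ → Θ ≋ (α ∨ β) ∷ Γ →
          L ⊢ α ∷ Γ ⇒ γ →
          L ⊢ β ∷ Γ ⇒ γ →
          L ⊢ Θ ⇒ γ

  ∨right1 : ∀ {Θ} α β Γ → Θ ≋ Γ →
            L ⊢ Γ ⇒ α →
            L ⊢ Θ ⇒ α ∨ β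

  ∨right2 : ∀ {Θ} α β Γ → Θ ≋ Γ →
            L ⊢ Γ ⇒ β →
            L ⊢ Θ ⇒ α ∨ β

  ∼left : ∀ {Θ} α γ Γ → Θ ≋ ∼ ∼ α ∷ Γ →
          L ⊢ α ∷ Γ ⇒ γ →
          L ⊢ Θ ⇒ γ

  ∼right : ∀ {Θ} α Γ → Θ ≋ Γ →
           L ⊢ Γ ⇒ α →
           L ⊢ Θ ⇒ ∼ ∼ α

  ∼⊃left : ∀ {Θ} α β γ Γ Δ → Θ ≋ ∼ (α ⊃ β) ∷ Γ ++ Δ →
           L ⊢ Γ ⇒ α →
           L ⊢ ∼ β ∷ Δ ⇒ γ →
           L ⊢ Θ ⇒ γ

  ∼⊃right : ∀ {Θ} α β Γ → Θ ≋ Γ →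
            L ⊢ α ∷ Γ ⇒ ∼ β →
            L ⊢ Θ ⇒ ∼ (α ⊃ β)

  ∼∧left : ∀ {Θ} α β γ Γ → Θ ≋ ∼ (α ∧ β) ∷ Γ →
           L ⊢ ∼ α ∷ Γ ⇒ γ →
           L ⊢ ∼ β ∷ Γ ⇒ γ →
           L ⊢ Θ ⇒ γ

  ∼∧right1 : ∀ {Θ} α β Γ → Θ ≋ Γ →
             L ⊢ Γ ⇒ ∼ α →
             L ⊢ Θ ⇒ ∼ (α ∧ β)

  ∼∧right2 : ∀ {Θ} α β Γ → Θ ≋ Γ →
             L ⊢ Γ ⇒ ∼ β →
             L ⊢ Θ ⇒ ∼ (α ∧ β)

  ∼∨left : ∀ {Θ} α β γ Γ → Θ ≋ ∼ (α ∨ β) ∷ Γ →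
           L ⊢ ∼ α ∷ ∼ β ∷ Γ ⇒ γ →
           L ⊢ Θ ⇒ γ

  ∼∨right : ∀ {Θ} α β Γ → Θ ≋ Γ →
            L ⊢ Γ ⇒ ∼ α →
            L ⊢ Γ ⇒ ∼ β →
            L ⊢ Θ ⇒ ∼ (α ∨ β)

  ex-middle : ∀ {Θ} α γ Γ → ex-middle ∈ L → Θ ≋ Γ →
              L ⊢ ∼ α ∷ Γ ⇒ γ →
              L ⊢ α ∷ Γ ⇒ γ →
              L ⊢ Θ ⇒ γ

  g-ex-middle : ∀ {Θ} α β γ Γ → g-ex-middle ∈ L → Θ ≋ Γ →
                L ⊢ (α ⊃ β) ∷ Γ ⇒ γ →
                L ⊢ α ∷ Γ ⇒ γ →
                L ⊢ Θ ⇒ γ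

{-# OPTIONS --safe #-}
module Submission where

open import Defs
open import Data.List using (_∷_; _++_)
open import Data.List.Membership.Propositional using (_∈_)
open import Data.List.Membership.Propositional.Properties using (∈-++⁻)
open import Data.List.Relation.Binary.Subset.Propositional using (_⊆_)
open import Data.List.Relation.Binary.Subset.Propositional.Properties
  using (⊆-refl; ⊆-trans; xs⊆x∷xs; xs⊆xs++ys; xs⊆ys++xs; ∷⁺ʳ; ∈-∷⁺ʳ)
open import Data.List.Relation.Unary.Any using (here)
open import Data.Sum using (_⊎_; [_,_])
open import Function using (id; _∘_; mk⇔; module Equivalence)
open import Relation.Binary.PropositionalEquality using (_≡_; refl)

-- The side formulas of every rule are arbitrary and antecedents are sets, so each
-- rule can be reapplied with the whole enlarged antecedent Δ as the context of all
-- its premises: the principal formula and repeated copies of Δ are absorbed by Δ.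

private
  variable
    Γ Γ′ Δ : FiniteSet
    α γ : Formula
    L : Calculus

≋⇒⊇ : Γ ≋ Δ → Δ ⊆ Γ
≋⇒⊇ Γ≋Δ = Equivalence.from Γ≋Δ

⊆-antisym : Γ ⊆ Δ → Δ ⊆ Γ → Γ ≋ Δ
⊆-antisym Γ⊆Δ Δ⊆Γ = mk⇔ Γ⊆Δ Δ⊆Γ

≋-refl : Δ ≋ Δ
≋-refl = ⊆-antisym id id

++-absorb : Δ ≋ Δ ++ Δ
++-absorb {Δ} = ⊆-antisym (xs⊆xs++ys Δ Δ) ([ id , id ] ∘ ∈-++⁻ Δ)

∷-absorb : α ∈ Δ → Δ ≋ α ∷ Δ
∷-absorb α∈Δ = ⊆-antisym (xs⊆x∷xs _ _) (∈-∷⁺ʳ α∈Δ ⊆-refl)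

∷-++-absorb : α ∈ Δ → Δ ≋ α ∷ Δ ++ Δ
∷-++-absorb {Δ = Δ} α∈Δ =
  ⊆-antisym (⊆-trans (xs⊆xs++ys Δ Δ) (xs⊆x∷xs _ _)) (∈-∷⁺ʳ α∈Δ (≋⇒⊇ ++-absorb))

weaken : Γ ⊆ Δ → L ⊢ Γ ⇒ γ → L ⊢ Δ ⇒ γ
weaken {Γ} {Δ} {L} Γ⊆Δ = go
  where
  sub : Γ ≋ Γ′ → Γ′ ⊆ Δ
  sub e = Γ⊆Δ ∘ ≋⇒⊇ e

  principal : Γ ≋ α ∷ Γ′ → α ∈ Δ
  principal e = sub e (here refl)

  side : Γ ≋ α ∷ Γ′ → Γ′ ⊆ Δ
  side e = sub e ∘ xs⊆x∷xs _ _

  sideˡ : ∀ Γ₁ Γ₂ → Γ ≋ α ∷ Γ₁ ++ Γ₂ → Γ₁ ⊆ Δ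
  sideˡ Γ₁ Γ₂ e = side e ∘ xs⊆xs++ys Γ₁ Γ₂

  sideʳ : ∀ Γ₁ Γ₂ → Γ ≋ α ∷ Γ₁ ++ Γ₂ → Γ₂ ⊆ Δ
  sideʳ Γ₁ Γ₂ e = side e ∘ xs⊆ys++xs Γ₂ Γ₁

  go : L ⊢ Γ ⇒ γ → L ⊢ Δ ⇒ γ
  go (init1 p _ e) = init1 p Δ (∷-absorb (principal e))
  go (init2 p _ e) = init2 p Δ (∷-absorb (principal e))
  go (cut α γ Γ₁ Γ₂ r e d₁ d₂) = cut α γ Δ Δ r ++-absorb
    (weaken (sub e ∘ xs⊆xs++ys Γ₁ Γ₂) d₁)
    (weaken (∷⁺ʳ α (sub e ∘ xs⊆ys++xs Γ₂ Γ₁)) d₂)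
  go (⊃left α β γ Γ₁ Γ₂ e d₁ d₂) = ⊃left α β γ Δ Δ (∷-++-absorb (principal e))
    (weaken (sideˡ Γ₁ Γ₂ e) d₁)
    (weaken (∷⁺ʳ β (sideʳ Γ₁ Γ₂ e)) d₂)
  go (⊃right α β _ e d) = ⊃right α β Δ ≋-refl (weaken (∷⁺ʳ α (sub e)) d)
  go (∧left α β γ _ e d) = ∧left α β γ Δ (∷-absorb (principal e))
    (weaken (∷⁺ʳ α (∷⁺ʳ β (side e))) d)
  go (∧right α β _ e d₁ d₂) = ∧right α β Δ ≋-refl (weaken (sub e) d₁) (weaken (sub e) d₂)
  go (∨left α β γ _ e d₁ d₂) = ∨left α β γ Δ (∷-absorb (principal e))
    (weaken (∷⁺ʳ α (side e)) d₁)
    (weaken (∷⁺ʳ β (side e)) d₂)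
  go (∨right1 α β _ e d) = ∨right1 α β Δ ≋-refl (weaken (sub e) d)
  go (∨right2 α β _ e d) = ∨right2 α β Δ ≋-refl (weaken (sub e) d)
  go (∼left α γ _ e d) = ∼left α γ Δ (∷-absorb (principal e)) (weaken (∷⁺ʳ α (side e)) d)
  go (∼right α _ e d) = ∼right α Δ ≋-refl (weaken (sub e) d)
  go (∼⊃left α β γ Γ₁ Γ₂ e d₁ d₂) = ∼⊃left α β γ Δ Δ (∷-++-absorb (principal e))
    (weaken (sideˡ Γ₁ Γ₂ e) d₁)
    (weaken (∷⁺ʳ (∼ β) (sideʳ Γ₁ Γ₂ e)) d₂)
  go (∼⊃right α β _ e d) = ∼⊃right α β Δ ≋-refl (weaken (∷⁺ʳ α (sub e)) d)
  go (∼∧left α β γ _ e d₁ d₂) = ∼∧left α β γ Δ (∷-absorb (principal e))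
    (weaken (∷⁺ʳ (∼ α) (side e)) d₁)
    (weaken (∷⁺ʳ (∼ β) (side e)) d₂)
  go (∼∧right1 α β _ e d) = ∼∧right1 α β Δ ≋-refl (weaken (sub e) d)
  go (∼∧right2 α β _ e d) = ∼∧right2 α β Δ ≋-refl (weaken (sub e) d)
  go (∼∨left α β γ _ e d) = ∼∨left α β γ Δ (∷-absorb (principal e))
    (weaken (∷⁺ʳ (∼ α) (∷⁺ʳ (∼ β) (side e))) d)
  go (∼∨right α β _ e d₁ d₂) = ∼∨right α β Δ ≋-refl (weaken (sub e) d₁) (weaken (sub e) d₂)
  go (ex-middle α γ _ r e d₁ d₂) = ex-middle α γ Δ r ≋-refl
    (weaken (∷⁺ʳ (∼ α) (sub e)) d₁)
    (weaken (∷⁺ʳ α (sub e)) d₂)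
  go (g-ex-middle α β γ _ r e d₁ d₂) = g-ex-middle α β γ Δ r ≋-refl
    (weaken (∷⁺ʳ (α ⊃ β) (sub e)) d₁)
    (weaken (∷⁺ʳ α (sub e)) d₂)

proposition2p11 : ∀ (L : Calculus) → L ≡ sMC* ⊎ L ≡ sCN* → ∀ (Γ : FiniteSet) (α γ : Formula) → (L -cut) ⊢ Γ ⇒ γ → (L -cut) ⊢ α ∷ Γ ⇒ γ
proposition2p11 L _ Γ α γ = weaken (xs⊆x∷xs Γ α)
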